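{- For every integer $n\ge 0$, \[ s_{n+1}^{(3)}=\frac{1}{n+1}\sum_{i=0}^n(-2)^{n-i}\binom{n+1}{i}\left(\sum_{j=0}^i\binom{i}{j}\binom{2i+j}{n}\right), \] where $s_{n+1}^{(3)}$ denotes the $(n+1)$-th small $3$-Schröder number.
   Context: Let $m\ge 2$ and $n\ge 1$ be integers. An $m$-Schröder path of length $mn$ is a lattice path from $(0,0)$ to $(mn,0)$ which never goes below the $x$-axis, with steps $U=(1,1)$, $D^{(m)}=(1,1-m)$ and $H^{(m)}=(2,2-m)$. A small $m$-Schröder path is an $m$-Schröder path with no step of type $H^{(m)}$ ending on the $x$-axis. The $n$-th small $m$-Schröder number $s_n^{(m)}$ is the number of small $m$-Schröder paths of length $mn$. (So for $m=3$ the steps are $(1,1)$, $(1,-2)$, $(2,-1)$, and $s_{n+1}^{(3)}$ counts small $3$-Schröder paths from $(0,0)$ to $(3(n+1),0)$.) For non-negative integers $a,b$, $\binom{a}{b}=0$ if $b>a$. -}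

module Defs where

open import Data.Integer.Base using (ℤ; +_; 0ℤ; 1ℤ)
import Data.Integer.Base as ℤ
import Data.Integer.Properties as ℤ
open import Data.List.Base using (List; []; _∷_; _++_; map; filter; length)
open import Data.List.Membership.Propositional using (_∈_)
open import Data.List.Membership.Propositional.Properties using (∈-map⁺; ∈-map⁻; ∈-++⁺ˡ; ∈-++⁺ʳ; ∈-++⁻; ∈-filter⁺; ∈-filter⁻)
open import Data.List.Properties using (∷-injectiveʳ)
open import Data.List.Relation.Unary.All as All using (All; []; all?)
open import Data.List.Relation.Unary.AllPairs using ([]; _∷_)
open import Data.List.Relation.Unary.Any using (here; there)
open import Data.List.Relation.Unary.Unique.Propositional using (Unique)
import Data.List.Relation.Unary.Unique.Propositional.Properties as Unique
open import Data.Nat.Base using (ℕ; zero; suc)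
import Data.Nat.Base as ℕ
open import Data.Product.Base using (_×_; _,_; proj₁; proj₂)
open import Data.Product.Properties using (≡-dec)
open import Data.Sum.Base using (inj₁; inj₂)
open import Function.Bundles using (_⇔_; mk⇔)
open import Relation.Binary.Definitions using (DecidableEquality)
open import Relation.Binary.PropositionalEquality using (_≡_; refl; sym; trans; cong; subst)
open import Relation.Nullary using (¬_; yes; no)
open import Relation.Nullary.Decidable using (¬?; _×-dec_)
open import Relation.Unary using (Decidable)

data Step : Set where
  U D H : Step

Point : Set
Point = ℤ × ℤ

origin : Point
origin = 0ℤ , 0ℤ

dx : Step → ℕ
dx U = 1
dx D = 1
dx H = 2

dy : ℕ → Step → ℤ
dy m U = 1ℤ
dy m D = + 1 ℤ.- + m
dy m H = + 2 ℤ.- + m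

move : ℕ → Step → Point → Point
move m s (x , y) = x ℤ.+ + dx s , y ℤ.+ dy m s

-- Each step of the path starting at p, paired with the point where it ends.
trace : ℕ → Point → List Step → List (Step × Point)
trace m p []      = []
trace m p (s ∷ w) = (s , move m s p) ∷ trace m (move m s p) w

endpoint : ℕ → Point → List Step → Point
endpoint m p []      = p
endpoint m p (s ∷ w) = endpoint m (move m s p) w

-- The step sequence w, started at the origin, is an m-Schröder path of length
-- mn.  Steps are straight segments, so a path never goes below the x-axis
-- exactly when none of its vertices does; the initial vertex lies on the axis.
IsSchröderPath : ℕ → ℕ → List Step → Set
IsSchröderPath m n w =
  endpoint m origin w ≡ (+ (m ℕ.* n) , 0ℤ) ×
  All (λ (_ , _ , y) → 0ℤ ℤ.≤ y) (trace m origin w)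

IsSmallSchröderPath : ℕ → ℕ → List Step → Set
IsSmallSchröderPath m n w =
  IsSchröderPath m n w ×
  All (λ (s , _ , y) → ¬ (s ≡ H × y ≡ 0ℤ)) (trace m origin w)

_≟ˢ_ : DecidableEquality Step
U ≟ˢ U = yes refl
U ≟ˢ D = no λ ()
U ≟ˢ H = no λ ()
D ≟ˢ U = no λ ()
D ≟ˢ D = yes refl
D ≟ˢ H = no λ ()
H ≟ˢ U = no λ ()
H ≟ˢ D = no λ ()
H ≟ˢ H = yes refl

isSmallSchröderPath? : ∀ m n → Decidable (IsSmallSchröderPath m n)
isSmallSchröderPath? m n w =
  (≡-dec ℤ._≟_ ℤ._≟_ _ _ ×-dec all? (λ (_ , _ , y) → 0ℤ ℤ.≤? y) _) ×-dec
  all? (λ (s , _ , y) → ¬? ((s ≟ˢ H) ×-dec (y ℤ.≟ 0ℤ))) _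

-- All step sequences of total horizontal length k.
words : ℕ → List (List Step)
words zero          = [] ∷ []
words (suc zero)    = (U ∷ []) ∷ (D ∷ []) ∷ []
words (suc (suc k)) =
  map (U ∷_) (words (suc k)) ++ map (D ∷_) (words (suc k)) ++ map (H ∷_) (words k)

smallSchröderPaths : ℕ → ℕ → List (List Step)
smallSchröderPaths m n = filter (isSmallSchröderPath? m n) (words (m ℕ.* n))

-- The n-th small m-Schröder number (meant for m ≥ 2 and n ≥ 1).  The lemmas
-- ∈-smallSchröderPaths and smallSchröderPaths-unique below show that the list
-- contains every small m-Schröder path of length mn exactly once, and nothing
-- else, so that its length is the number of such paths.
smallSchröder : ℕ → ℕ → ℕ
smallSchröder m n = length (smallSchröderPaths m n)

width : List Step → ℕ
width []      = 0
width (s ∷ w) = dx s ℕ.+ width w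

U∷-∈-words : ∀ k {w} → w ∈ words k → U ∷ w ∈ words (suc k)
U∷-∈-words zero    (here refl) = here refl
U∷-∈-words (suc k) p           = ∈-++⁺ˡ (∈-map⁺ (U ∷_) p)

D∷-∈-words : ∀ k {w} → w ∈ words k → D ∷ w ∈ words (suc k)
D∷-∈-words zero    (here refl) = there (here refl)
D∷-∈-words (suc k) p           =
  ∈-++⁺ʳ (map (U ∷_) (words (suc k))) (∈-++⁺ˡ (∈-map⁺ (D ∷_) p))

H∷-∈-words : ∀ k {w} → w ∈ words k → H ∷ w ∈ words (suc (suc k))
H∷-∈-words k p =
  ∈-++⁺ʳ (map (U ∷_) (words (suc k)))
    (∈-++⁺ʳ (map (D ∷_) (words (suc k))) (∈-map⁺ (H ∷_) p))

∈-words : ∀ w → w ∈ words (width w)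
∈-words []      = here refl
∈-words (U ∷ w) = U∷-∈-words (width w) (∈-words w)
∈-words (D ∷ w) = D∷-∈-words (width w) (∈-words w)
∈-words (H ∷ w) = H∷-∈-words (width w) (∈-words w)

words-unique : ∀ k → Unique (words k)
words-unique zero          = [] ∷ []
words-unique (suc zero)    = ((λ ()) All.∷ []) ∷ [] ∷ []
words-unique (suc (suc k)) =
  Unique.++⁺ (Unique.map⁺ ∷-injectiveʳ (words-unique (suc k)))
    (Unique.++⁺ (Unique.map⁺ ∷-injectiveʳ (words-unique (suc k)))
                (Unique.map⁺ ∷-injectiveʳ (words-unique k))
                D#H)
    U#DH
  where
  D#H : ∀ {w} → ¬ (w ∈ map (D ∷_) (words (suc k)) × w ∈ map (H ∷_) (words k))
  D#H (p , q) with ∈-map⁻ (D ∷_) p | ∈-map⁻ (H ∷_) q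
  ... | _ , _ , refl | _ , _ , ()

  U#DH : ∀ {w} → ¬ (w ∈ map (U ∷_) (words (suc k)) ×
                    w ∈ map (D ∷_) (words (suc k)) ++ map (H ∷_) (words k))
  U#DH (p , q) with ∈-map⁻ (U ∷_) p | ∈-++⁻ (map (D ∷_) (words (suc k))) q
  ... | _ , _ , refl | inj₁ r with () ← proj₂ (proj₂ (∈-map⁻ (D ∷_) r))
  ... | _ , _ , refl | inj₂ r with () ← proj₂ (proj₂ (∈-map⁻ (H ∷_) r))

endpoint-x : ∀ m p w → proj₁ (endpoint m p w) ≡ proj₁ p ℤ.+ + width w
endpoint-x m (x , y) []      = sym (ℤ.+-identityʳ x)
endpoint-x m (x , y) (s ∷ w) =
  trans (endpoint-x m (move m s (x , y)) w) (ℤ.+-assoc x (+ dx s) (+ width w))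

∈-smallSchröderPaths : ∀ m n w → w ∈ smallSchröderPaths m n ⇔ IsSmallSchröderPath m n w
∈-smallSchröderPaths m n w = mk⇔
  (λ p → proj₂ (∈-filter⁻ (isSmallSchröderPath? m n) {xs = words (m ℕ.* n)} p))
  (λ { s@((e , _) , _) →
    ∈-filter⁺ (isSmallSchröderPath? m n) (subst (λ k → w ∈ words k) (width≡ e) (∈-words w)) s })
  where
  width≡ : endpoint m origin w ≡ (+ (m ℕ.* n) , 0ℤ) → width w ≡ m ℕ.* n
  width≡ e = ℤ.+-injective
    (trans (sym (ℤ.+-identityˡ (+ width w)))
      (trans (sym (endpoint-x m origin w)) (cong proj₁ e)))

smallSchröderPaths-unique : ∀ m n → Unique (smallSchröderPaths m n)
smallSchröderPaths-unique m n =
  Unique.filter⁺ (isSmallSchröderPath? m n) (words-unique (m ℕ.* n))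

module Submission where

-- The identity comes from Lagrange inversion.  Call a path prefix small if it never
-- goes below the axis and no H step of it ends on the axis, and let t mark the number of
-- steps of type D or H.  If S and R are the generating functions of the small and of
-- all 3-Schröder paths, then cutting a prefix at its last visits to the heights
-- 0, 1, ..., h - 1 shows that the small prefixes of height h have generating function
-- S Rʰ.  The path decompositions give R = 1 + t R³ + t R² and S = 1 + t S R², hence
-- R = 2 S - 1, and in terms of y = R - 1 these become
--
--   y = t G(y)   with G = (1 + y)² (2 + y),      2 S Rʰ = (2 + y) (1 + y)ʰ.
--
-- No decomposition of paths is carried out below.  Instead, A φ n F is the Lagrange
-- formula for the coefficient of tⁿ in F(y(t)) where y(t) = t φ(y(t)), and it satisfies
-- A φ (n + 1) (y F) = A φ n (φ F).  For φ = G and F h = (2 + y) (1 + y)ʰ this turns the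
-- identities F (h + 1) = F h + y F h and G F h = F (h + 3) + F (h + 2) into the recursion
-- that small prefixes obey when their last step is removed (prefixes-suc-suc).  Both
-- sides agree on the boundary, so 2*prefixes follows by induction.
--
-- At height 0 the lemma lagrange gives 2 (n + 1) s = [yⁿ] Gⁿ⁺¹ for the small Schröder
-- number s of index n + 1.  Since G has constant term 2, the coefficient of yⁿ in
-- (G - 2)ⁿ⁺¹ vanishes, and the binomial theorem expresses [yⁿ] Gⁿ⁺¹ through the
-- [yⁿ] Gⁱ with i ≤ n (top-power).  Expanding Gⁱ in powers of 1 + y (G-power) yields the
-- inner sum.

open import Defs
open import Data.Integer.Properties using (+-0-commutativeMonoid)
open import Algebra.Properties.CommutativeMonoid.Sum +-0-commutativeMonoid using (sum⁺-syntax)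
open import Data.Fin.Base using (toℕ)
open import Data.Integer.Base using (+_; 1ℤ; -_; _*_; _^_)
open import Data.Nat.Base as ℕ using (ℕ; suc; _∸_)
open import Data.Nat.Combinatorics using (_C_)
open import Data.Rational.Base as ℚ using (_/_)
open import Relation.Binary.PropositionalEquality using (_≡_)

open import Algebra.Bundles using (CommutativeRing)
import Algebra.Construct.Pointwise as Pointwise
open import Algebra.Properties.AbelianGroup Data.Integer.Properties.+-0-abelianGroup using () renaming (∙-cancelʳ to +-cancelʳ)
open import Algebra.Properties.CommutativeMonoid.Sum +-0-commutativeMonoid using (sum; sum-init-last; sum-cong-≗)
open import Algebra.Properties.Semiring.Sum Data.Integer.Properties.+-*-semiring using (*-distribˡ-sum)
open import Data.Bool.Base using (true; false)
open import Data.Fin.Base using (Fin; zero; suc; inject₁; fromℕ)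
open import Data.Fin.Properties using (toℕ-inject₁; toℕ-fromℕ; toℕ≤pred[n])
open import Data.Integer.Base as ℤ using (ℤ; 0ℤ; _+_; _-_)
import Data.Integer.Properties as ℤ
open import Data.Integer.Tactic.RingSolver using (solve-∀)
open import Data.List.Base using (List; []; _∷_; _++_; _∷ʳ_; map; filter; length)
open import Data.List.Properties using (filter-++; length-++; filter-≐)
open import Data.List.Relation.Unary.All as All using (All; []; _∷_)
open import Data.List.Relation.Unary.All.Properties using (∷ʳ⁺; ∷ʳ⁻)
open import Data.Nat.Base using (zero; s≤s)
open import Data.Nat.Combinatorics using (nCn≡1; nCk+nC[k+1]≡[n+1]C[k+1])
import Data.Nat.Properties as ℕ
import Data.Nat.Tactic.RingSolver as ℕ-Solver
open import Data.Product.Base using (_×_; _,_; proj₁; proj₂)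
open import Data.Product.Properties using (≡-dec)
import Data.Rational.Properties as ℚ
import Data.Rational.Unnormalised.Base as ℚᵘ
import Data.Rational.Unnormalised.Properties as ℚᵘ
open import Function.Base using (_∘_)
open import Function.Bundles using (_⇔_; mk⇔; Equivalence)
open import Level using (0ℓ)
open import Relation.Binary.PropositionalEquality using (_≢_; refl; sym; trans; cong; cong₂; subst; module ≡-Reasoning)
open import Relation.Nullary using (¬_; yes; no; does; contradiction)
open import Relation.Nullary.Decidable using (_×-dec_; ¬?)
open import Relation.Unary using (Pred; Decidable)

-- The ring of formal power series over the integers

-- A formal power series over the integers, as its sequence of coefficients;
-- equality is pointwise.
Series : Set
Series = ℕ → ℤ

infix 4 _≈_
_≈_ : Series → Series → Set
f ≈ g = ∀ n → f n ≡ g n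

infixl 6 _⊕_
_⊕_ : Series → Series → Series
(f ⊕ g) n = f n + g n

-- Removal of the constant term followed by division by the variable.
tail : Series → Series
tail f = f ∘ suc

-- The Cauchy product, by recursion on the index: f = f 0 + y (tail f).
infixl 7 _⊛_
_⊛_ : Series → Series → Series
(f ⊛ g) zero    = f 0 * g 0
(f ⊛ g) (suc n) = f 0 * g (suc n) + (tail f ⊛ g) n

-- The constant power series c.
const : ℤ → Series
const c zero    = c
const c (suc n) = 0ℤ

-- The variable.
y : Series
y zero    = 0ℤ
y (suc n) = const 1ℤ n

⊛-cong : ∀ {f f′ g g′} → f ≈ f′ → g ≈ g′ → f ⊛ g ≈ f′ ⊛ g′
⊛-cong p q zero    = cong₂ _*_ (p 0) (q 0)
⊛-cong p q (suc n) = cong₂ _+_ (cong₂ _*_ (p 0) (q (suc n))) (⊛-cong (p ∘ suc) q n)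

⊛-distribʳ : ∀ h f g → (f ⊕ g) ⊛ h ≈ f ⊛ h ⊕ g ⊛ h
⊛-distribʳ h f g zero    = ℤ.*-distribʳ-+ (h 0) (f 0) (g 0)
⊛-distribʳ h f g (suc n) = trans
  (cong (λ z → (f 0 + g 0) * h (suc n) + z) (⊛-distribʳ h (tail f) (tail g) n))
  (lemma (f 0) (g 0) (h (suc n)) ((tail f ⊛ h) n) ((tail g ⊛ h) n))
  where
  lemma : ∀ a b c u v → (a + b) * c + (u + v) ≡ (a * c + u) + (b * c + v)
  lemma = solve-∀

scale-⊛ : ∀ c f g → (λ n → c * f n) ⊛ g ≈ λ n → c * (f ⊛ g) n
scale-⊛ c f g zero    = ℤ.*-assoc c (f 0) (g 0)
scale-⊛ c f g (suc n) = trans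
  (cong (λ z → c * f 0 * g (suc n) + z) (scale-⊛ c (tail f) g n))
  (lemma c (f 0) (g (suc n)) ((tail f ⊛ g) n))
  where
  lemma : ∀ c a b u → c * a * b + c * u ≡ c * (a * b + u)
  lemma = solve-∀

-- The recursion for the Cauchy product with the roles of the factors exchanged;
-- commutativity follows from comparing the two.
⊛-suc : ∀ f g n → (f ⊛ g) (suc n) ≡ (f ⊛ tail g) n + f (suc n) * g 0
⊛-suc f g zero    = refl
⊛-suc f g (suc n) = trans
  (cong (λ z → f 0 * g (suc (suc n)) + z) (⊛-suc (tail f) g n))
  (sym (ℤ.+-assoc (f 0 * g (suc (suc n))) ((tail f ⊛ tail g) n) (f (suc (suc n)) * g 0)))

⊛-comm : ∀ f g → f ⊛ g ≈ g ⊛ f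
⊛-comm f g zero    = ℤ.*-comm (f 0) (g 0)
⊛-comm f g (suc n) = begin
  f 0 * g (suc n) + (tail f ⊛ g) n  ≡⟨ cong₂ _+_ (ℤ.*-comm (f 0) _) (⊛-comm (tail f) g n) ⟩
  g (suc n) * f 0 + (g ⊛ tail f) n  ≡⟨ ℤ.+-comm (g (suc n) * f 0) _ ⟩
  (g ⊛ tail f) n + g (suc n) * f 0  ≡⟨ ⊛-suc g f n ⟨
  (g ⊛ f) (suc n)                   ∎
  where open ≡-Reasoning

⊛-assoc : ∀ f g h → (f ⊛ g) ⊛ h ≈ f ⊛ (g ⊛ h)
⊛-assoc f g h zero    = ℤ.*-assoc (f 0) (g 0) (h 0)
⊛-assoc f g h (suc n) = begin
  f 0 * g 0 * h (suc n) + (((λ m → f 0 * tail g m) ⊕ tail f ⊛ g) ⊛ h) n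
    ≡⟨ cong (λ z → f 0 * g 0 * h (suc n) + z) (⊛-distribʳ h (λ m → f 0 * tail g m) (tail f ⊛ g) n) ⟩
  f 0 * g 0 * h (suc n) + (((λ m → f 0 * tail g m) ⊛ h) n + ((tail f ⊛ g) ⊛ h) n)
    ≡⟨ cong₂ (λ a b → f 0 * g 0 * h (suc n) + (a + b))
             (scale-⊛ (f 0) (tail g) h n) (⊛-assoc (tail f) g h n) ⟩
  f 0 * g 0 * h (suc n) + (f 0 * (tail g ⊛ h) n + (tail f ⊛ (g ⊛ h)) n)
    ≡⟨ lemma (f 0) (g 0) (h (suc n)) ((tail g ⊛ h) n) ((tail f ⊛ (g ⊛ h)) n) ⟩
  f 0 * (g 0 * h (suc n) + (tail g ⊛ h) n) + (tail f ⊛ (g ⊛ h)) n ∎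
  where
  open ≡-Reasoning
  lemma : ∀ a b c u v → a * b * c + (a * u + v) ≡ a * (b * c + u) + v
  lemma = solve-∀

const-⊛ : ∀ c f n → (const c ⊛ f) n ≡ c * f n
const-⊛ c f zero    = refl
const-⊛ c f (suc n) = trans (cong (λ z → c * f (suc n) + z) (vanish n)) (ℤ.+-identityʳ (c * f (suc n)))
  where
  vanish : (λ _ → 0ℤ) ⊛ f ≈ λ _ → 0ℤ
  vanish zero    = refl
  vanish (suc n) = trans (ℤ.+-identityˡ _) (vanish n)

seriesRing : CommutativeRing 0ℓ 0ℓ
seriesRing = record
  { Carrier = Series
  ; _≈_ = _≈_
  ; _+_ = _⊕_
  ; _*_ = _⊛_
  ; -_ = -_ ∘_
  ; 0# = λ _ → 0ℤ
  ; 1# = const 1ℤ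
  ; isCommutativeRing = record
    { isRing = record
      { +-isAbelianGroup = Pointwise.isAbelianGroup ℕ ℤ.+-0-isAbelianGroup
      ; *-cong = ⊛-cong
      ; *-assoc = ⊛-assoc
      ; *-identity = identityˡ , λ f n → trans (⊛-comm f (const 1ℤ) n) (identityˡ f n)
      ; distrib = (λ h f g n → trans (⊛-comm h (f ⊕ g) n)
                      (trans (⊛-distribʳ h f g n)
                             (cong₂ _+_ (⊛-comm f h n) (⊛-comm g h n))))
                , ⊛-distribʳ
      }
    ; *-comm = ⊛-comm
    }
  }
  where
  identityˡ : ∀ f → const 1ℤ ⊛ f ≈ f
  identityˡ f n = trans (const-⊛ 1ℤ f n) (ℤ.*-identityˡ (f n))

module S = CommutativeRing seriesRing
import Algebra.Properties.CommutativeSemiring.Binomial S.commutativeSemiring as Binomial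
open import Algebra.Properties.CommutativeSemiring.Exp S.commutativeSemiring using (^-distrib-*)
import Algebra.Properties.Monoid.Sum S.+-monoid as Sˢ
open import Algebra.Properties.Ring S.ring using (-‿distribʳ-*)
open import Algebra.Properties.Semiring.Exp S.semiring using (^-homo-*; ^-assocʳ) renaming (_^_ to _^ˢ_)
open import Algebra.Properties.Semiring.Mult S.semiring using (×-comm-*) renaming (_×_ to _×ˢ_)
open import Algebra.Properties.Semiring.Sum S.semiring using () renaming (*-distribˡ-sum to *-distribˡ-sumˢ)
import Algebra.Solver.Ring.NaturalCoefficients.Default S.commutativeSemiring as Solver
open Solver using (_:+_; _:*_; _:=_; con)

y-⊛ : ∀ f n → (y ⊛ f) (suc n) ≡ f n
y-⊛ f n = trans (ℤ.+-identityˡ ((const 1ℤ ⊛ f) n)) (S.*-identityˡ f n)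

-- The Euler derivation y d/dy.
θ : Series → Series
θ f n = + n * f n

θ-⊛ : ∀ f g → θ (f ⊛ g) ≈ θ f ⊛ g ⊕ f ⊛ θ g
θ-⊛ f g zero    = lemma (f 0) (g 0)
  where
  lemma : ∀ a b → 0ℤ * (a * b) ≡ 0ℤ * a * b + a * (0ℤ * b)
  lemma = solve-∀
θ-⊛ f g (suc n) = begin
  + suc n * (f 0 * g (suc n) + (tail f ⊛ g) n)
    ≡⟨ expand (+ n) (f 0 * g (suc n)) ((tail f ⊛ g) n) ⟩
  + suc n * (f 0 * g (suc n)) + ((tail f ⊛ g) n + θ (tail f ⊛ g) n)
    ≡⟨ cong (λ z → + suc n * (f 0 * g (suc n)) + ((tail f ⊛ g) n + z)) (θ-⊛ (tail f) g n) ⟩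
  + suc n * (f 0 * g (suc n)) + ((tail f ⊛ g) n + ((θ (tail f) ⊛ g) n + (tail f ⊛ θ g) n))
    ≡⟨ regroup (+ n) (f 0) (g (suc n)) ((tail f ⊛ g) n) ((θ (tail f) ⊛ g) n) ((tail f ⊛ θ g) n) ⟩
  (0ℤ * f 0 * g (suc n) + ((tail f ⊛ g) n + (θ (tail f) ⊛ g) n)) + (f ⊛ θ g) (suc n)
    ≡⟨ cong (λ z → (0ℤ * f 0 * g (suc n) + z) + (f ⊛ θ g) (suc n)) collect ⟨
  (θ f ⊛ g) (suc n) + (f ⊛ θ g) (suc n) ∎
  where
  open ≡-Reasoning
  expand : ∀ n a b → (1ℤ + n) * (a + b) ≡ (1ℤ + n) * a + (b + n * b)
  expand = solve-∀
  regroup : ∀ n a b c d e → (1ℤ + n) * (a * b) + (c + (d + e)) ≡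
                            (0ℤ * a * b + (c + d)) + (a * ((1ℤ + n) * b) + e)
  regroup = solve-∀
  suc-* : ∀ n a → (1ℤ + n) * a ≡ a + n * a
  suc-* = solve-∀
  collect : (tail (θ f) ⊛ g) n ≡ (tail f ⊛ g) n + (θ (tail f) ⊛ g) n
  collect = trans (⊛-cong {g = g} (λ m → suc-* (+ m) (f (suc m))) (λ _ → refl) n)
                  (⊛-distribʳ g (tail f) (θ (tail f)) n)

θ-power : ∀ φ n m → θ (φ ^ˢ suc n) m ≡ + suc n * (φ ^ˢ n ⊛ θ φ) m
θ-power φ zero m = begin
  θ (φ ⊛ const 1ℤ) m                       ≡⟨ cong (+ m *_) (S.*-identityʳ φ m) ⟩
  θ φ m                                    ≡⟨ S.*-identityˡ (θ φ) m ⟨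
  (const 1ℤ ⊛ θ φ) m                       ≡⟨ ℤ.*-identityˡ _ ⟨
  1ℤ * (const 1ℤ ⊛ θ φ) m                  ∎
  where open ≡-Reasoning
θ-power φ (suc n) m = begin
  θ (φ ⊛ φ ^ˢ suc n) m
    ≡⟨ θ-⊛ φ (φ ^ˢ suc n) m ⟩
  (θ φ ⊛ φ ^ˢ suc n) m + (φ ⊛ θ (φ ^ˢ suc n)) m
    ≡⟨ cong₂ _+_ (⊛-comm (θ φ) (φ ^ˢ suc n) m) step ⟩
  (φ ^ˢ suc n ⊛ θ φ) m + + suc n * (φ ^ˢ suc n ⊛ θ φ) m
    ≡⟨ lemma (+ n) ((φ ^ˢ suc n ⊛ θ φ) m) ⟩
  + suc (suc n) * (φ ^ˢ suc n ⊛ θ φ) m ∎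
  where
  open ≡-Reasoning
  lemma : ∀ n a → a + (1ℤ + n) * a ≡ (1ℤ + (1ℤ + n)) * a
  lemma = solve-∀
  step : (φ ⊛ θ (φ ^ˢ suc n)) m ≡ + suc n * (φ ^ˢ suc n ⊛ θ φ) m
  step = begin
    (φ ⊛ θ (φ ^ˢ suc n)) m                     ≡⟨ ⊛-comm φ (θ (φ ^ˢ suc n)) m ⟩
    (θ (φ ^ˢ suc n) ⊛ φ) m                     ≡⟨ ⊛-cong {g = φ} (θ-power φ n) (λ _ → refl) m ⟩
    ((λ k → + suc n * (φ ^ˢ n ⊛ θ φ) k) ⊛ φ) m ≡⟨ scale-⊛ (+ suc n) (φ ^ˢ n ⊛ θ φ) φ m ⟩
    + suc n * (φ ^ˢ n ⊛ θ φ ⊛ φ) m             ≡⟨ cong (+ suc n *_) (rotate (φ ^ˢ n) (θ φ) φ m) ⟩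
    + suc n * (φ ^ˢ suc n ⊛ θ φ) m             ∎
    where
    rotate : ∀ a b c → a ⊛ b ⊛ c ≈ c ⊛ a ⊛ b
    rotate = Solver.solve 3 (λ a b c → a :* b :* c := c :* a :* b) (λ _ → refl)

-- Lagrange inversion

-- In this module y(t) is the power series solution of y(t) = t φ(y(t)).
module _ (φ : Series) where

  -- φ - y φ′.
  κ : Series
  κ m = φ m + - θ φ m

  -- The two sides compare θ (φ ^ (n + 1)) with its expansion by the power rule.
  κ-power : ∀ n m → + suc n * (φ ^ˢ n ⊛ κ) m ≡ (+ suc n - + m) * (φ ^ˢ suc n) m
  κ-power n m = begin
    + suc n * (φ ^ˢ n ⊛ κ) m
      ≡⟨ cong (+ suc n *_) split ⟩
    + suc n * ((φ ^ˢ suc n) m + - (φ ^ˢ n ⊛ θ φ) m)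
      ≡⟨ distrib (+ suc n) ((φ ^ˢ suc n) m) ((φ ^ˢ n ⊛ θ φ) m) ⟩
    + suc n * (φ ^ˢ suc n) m - + suc n * (φ ^ˢ n ⊛ θ φ) m
      ≡⟨ cong (λ z → + suc n * (φ ^ˢ suc n) m - z) (θ-power φ n m) ⟨
    + suc n * (φ ^ˢ suc n) m - + m * (φ ^ˢ suc n) m
      ≡⟨ collect (+ suc n) (+ m) ((φ ^ˢ suc n) m) ⟩
    (+ suc n - + m) * (φ ^ˢ suc n) m ∎
    where
    open ≡-Reasoning
    distrib : ∀ c a b → c * (a + - b) ≡ c * a - c * b
    distrib = solve-∀
    collect : ∀ a b c → a * c - b * c ≡ (a - b) * c
    collect = solve-∀
    split : (φ ^ˢ n ⊛ κ) m ≡ (φ ^ˢ suc n) m + - (φ ^ˢ n ⊛ θ φ) m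
    split = trans (S.distribˡ (φ ^ˢ n) φ (-_ ∘ θ φ) m)
      (cong₂ _+_ (⊛-comm (φ ^ˢ n) φ m) (sym (-‿distribʳ-* (φ ^ˢ n) (θ φ) m)))

  -- The coefficient of tⁿ in F(y(t)), given by the form of Lagrange inversion
  -- that needs no division: it is the coefficient of yⁿ in F φⁿ⁻¹ (φ - y φ′).
  -- Since y(t) vanishes at t = 0, the coefficient for n = 0 is the constant term of F.
  A : ℕ → Series → ℤ
  A zero    F = F 0
  A (suc n) F = (F ⊛ (φ ^ˢ n ⊛ κ)) (suc n)

  A-cong : ∀ n {F F′} → F ≈ F′ → A n F ≡ A n F′
  A-cong zero    p = p 0
  A-cong (suc n) p = ⊛-cong {g = φ ^ˢ n ⊛ κ} p (λ _ → refl) (suc n)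

  A-⊕ : ∀ n F F′ → A n (F ⊕ F′) ≡ A n F + A n F′
  A-⊕ zero    F F′ = refl
  A-⊕ (suc n) F F′ = ⊛-distribʳ (φ ^ˢ n ⊛ κ) F F′ (suc n)

  -- The functional equation y(t) = t φ(y(t)).
  A-y : ∀ n F → A (suc n) (y ⊛ F) ≡ A n (φ ⊛ F)
  A-y n F = trans (⊛-assoc y F (φ ^ˢ n ⊛ κ) (suc n))
    (trans (y-⊛ (F ⊛ (φ ^ˢ n ⊛ κ)) n) (absorb n))
    where
    absorb : ∀ n → (F ⊛ (φ ^ˢ n ⊛ κ)) n ≡ A n (φ ⊛ F)
    absorb zero    = lemma (F 0) (φ 0)
      where
      lemma : ∀ a b → a * (1ℤ * (b + - (0ℤ * b))) ≡ b * a
      lemma = solve-∀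
    absorb (suc n) = Solver.solve 4
      (λ f p q k → f :* (p :* q :* k) := p :* f :* (q :* k))
      (λ _ → refl) F φ (φ ^ˢ n) κ (suc n)

  -- The constant series 1 stays constant under substitution.
  A-1 : ∀ n → A (suc n) (const 1ℤ) ≡ 0ℤ
  A-1 n = trans (S.*-identityˡ (φ ^ˢ n ⊛ κ) (suc n))
    (ℤ.*-cancelˡ-≡ (+ suc n) _ 0ℤ (begin
      + suc n * (φ ^ˢ n ⊛ κ) (suc n)              ≡⟨ κ-power n (suc n) ⟩
      (+ suc n - + suc n) * (φ ^ˢ suc n) (suc n)  ≡⟨ cong (_* (φ ^ˢ suc n) (suc n)) (ℤ.+-inverseʳ (+ suc n)) ⟩
      0ℤ * (φ ^ˢ suc n) (suc n)                   ≡⟨ ℤ.*-zeroˡ ((φ ^ˢ suc n) (suc n)) ⟩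
      0ℤ                                          ≡⟨ ℤ.*-zeroʳ (+ suc n) ⟨
      + suc n * 0ℤ                                ∎))
    where open ≡-Reasoning

  -- Lagrange inversion for the coefficients of y(t) itself.
  lagrange : ∀ n → + suc n * A (suc n) y ≡ (φ ^ˢ suc n) n
  lagrange n = begin
    + suc n * (y ⊛ (φ ^ˢ n ⊛ κ)) (suc n)  ≡⟨ cong (+ suc n *_) (y-⊛ (φ ^ˢ n ⊛ κ) n) ⟩
    + suc n * (φ ^ˢ n ⊛ κ) n              ≡⟨ κ-power n n ⟩
    (+ suc n - + n) * (φ ^ˢ suc n) n      ≡⟨ lemma (+ n) ((φ ^ˢ suc n) n) ⟩
    (φ ^ˢ suc n) n                        ∎
    where
    open ≡-Reasoning
    lemma : ∀ n a → (1ℤ + n - n) * a ≡ a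
    lemma = solve-∀

-- Counting small paths by their last step

private
  variable
    P Q : Pred (List Step) 0ℓ

-- The number of entries of a list that satisfy P.
count : Decidable P → List (List Step) → ℕ
count P? ws = length (filter P? ws)

count-++ : (P? : Decidable P) → ∀ vs ws → count P? (vs ++ ws) ≡ count P? vs ℕ.+ count P? ws
count-++ P? vs ws = trans (cong length (filter-++ P? vs ws)) (length-++ (filter P? vs))

count-map : (P? : Decidable P) (f : List Step → List Step) →
            ∀ ws → count P? (map f ws) ≡ count (P? ∘ f) ws
count-map P? f []       = refl
count-map P? f (w ∷ ws) with does (P? (f w))
... | true  = cong suc (count-map P? f ws)
... | false = count-map P? f ws

count-⇔ : (P? : Decidable P) (Q? : Decidable Q) → (∀ w → P w ⇔ Q w) →
          ∀ ws → count P? ws ≡ count Q? ws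
count-⇔ P? Q? P⇔Q ws = cong length
  (filter-≐ P? Q? ((λ {w} → Equivalence.to (P⇔Q w)) , (λ {w} → Equivalence.from (P⇔Q w))) ws)

count-none : (P? : Decidable P) → (∀ w → ¬ P w) → ∀ ws → count P? ws ≡ 0
count-none P? ¬P []       = refl
count-none P? ¬P (w ∷ ws) with P? w
... | yes p = contradiction p (¬P w)
... | no _  = count-none P? ¬P ws

count-singleton : (P? : Decidable P) (Q? : Decidable Q) → ∀ w → does (P? w) ≡ does (Q? w) →
                  count P? (w ∷ []) ≡ count Q? (w ∷ [])
count-singleton P? Q? w eq with does (P? w) | does (Q? w)
count-singleton P? Q? w refl | true  | true  = refl
count-singleton P? Q? w refl | false | false = refl

-- The step sequences of total horizontal length k - 1; there are none when k = 0.
-- With this convention an H step can be split off at every length.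
words⁻ : ℕ → List (List Step)
words⁻ zero    = []
words⁻ (suc k) = words k

count-first : ∀ k (P? : Decidable P) →
  count P? (words (suc k)) ≡ count (P? ∘ (U ∷_)) (words k)
                             ℕ.+ (count (P? ∘ (D ∷_)) (words k) ℕ.+ count (P? ∘ (H ∷_)) (words⁻ k))
count-first k P? = begin
  count P? (words (suc k))
    ≡⟨ cong (count P?) (words-suc k) ⟩
  count P? (map (U ∷_) (words k) ++ map (D ∷_) (words k) ++ map (H ∷_) (words⁻ k))
    ≡⟨ count-++ P? (map (U ∷_) (words k)) _ ⟩
  count P? (map (U ∷_) (words k)) ℕ.+ count P? (map (D ∷_) (words k) ++ map (H ∷_) (words⁻ k))
    ≡⟨ cong₂ ℕ._+_ (count-map P? (U ∷_) (words k)) (trans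
         (count-++ P? (map (D ∷_) (words k)) _)
         (cong₂ ℕ._+_ (count-map P? (D ∷_) (words k)) (count-map P? (H ∷_) (words⁻ k)))) ⟩
  count (P? ∘ (U ∷_)) (words k)
    ℕ.+ (count (P? ∘ (D ∷_)) (words k) ℕ.+ count (P? ∘ (H ∷_)) (words⁻ k)) ∎
  where
  open ≡-Reasoning
  words-suc : ∀ k → words (suc k) ≡
              map (U ∷_) (words k) ++ map (D ∷_) (words k) ++ map (H ∷_) (words⁻ k)
  words-suc zero    = refl
  words-suc (suc k) = refl

-- The words of a given length can be generated by their last step as well as
-- by their first: splitting off both ends in either order gives the same terms.
count-last : ∀ k (P? : Decidable P) →
  count P? (words (suc k)) ≡ count (P? ∘ (_∷ʳ U)) (words k)
                             ℕ.+ (count (P? ∘ (_∷ʳ D)) (words k) ℕ.+ count (P? ∘ (_∷ʳ H)) (words⁻ k))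
count-last zero    P? = trans (count-first zero P?)
  (cong₂ (λ a b → a ℕ.+ (b ℕ.+ 0))
    (count-singleton (P? ∘ (U ∷_)) (P? ∘ (_∷ʳ U)) [] refl)
    (count-singleton (P? ∘ (D ∷_)) (P? ∘ (_∷ʳ D)) [] refl))
count-last (suc k) P? = begin
  count P? (words (2 ℕ.+ k))
    ≡⟨ count-first (suc k) P? ⟩
  count (P? ∘ (U ∷_)) (words (suc k))
    ℕ.+ (count (P? ∘ (D ∷_)) (words (suc k)) ℕ.+ count (P? ∘ (H ∷_)) (words k))
    ≡⟨ cong₂ (λ a b → a ℕ.+ (b ℕ.+ count (P? ∘ (H ∷_)) (words k)))
         (count-last k (P? ∘ (U ∷_))) (count-last k (P? ∘ (D ∷_))) ⟩
  (uu ℕ.+ (ud ℕ.+ uh)) ℕ.+ ((du ℕ.+ (dd ℕ.+ dh)) ℕ.+ count (P? ∘ (H ∷_)) (words k))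
    ≡⟨ regroup uu ud uh du dd dh _ ⟩
  uu ℕ.+ du ℕ.+ (ud ℕ.+ dd) ℕ.+ (count (P? ∘ (H ∷_)) (words k) ℕ.+ (uh ℕ.+ dh))
    ≡⟨ cong (λ z → uu ℕ.+ du ℕ.+ (ud ℕ.+ dd) ℕ.+ z) (edge k) ⟩
  uu ℕ.+ du ℕ.+ (ud ℕ.+ dd) ℕ.+ (count (P? ∘ (_∷ʳ H)) (words k) ℕ.+ (hu ℕ.+ hd))
    ≡⟨ ungroup uu ud hu du dd hd _ ⟩
  (uu ℕ.+ (du ℕ.+ hu)) ℕ.+ ((ud ℕ.+ (dd ℕ.+ hd)) ℕ.+ count (P? ∘ (_∷ʳ H)) (words k))
    ≡⟨ cong₂ (λ a b → a ℕ.+ (b ℕ.+ count (P? ∘ (_∷ʳ H)) (words k)))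
         (count-first k (P? ∘ (_∷ʳ U))) (count-first k (P? ∘ (_∷ʳ D))) ⟨
  count (P? ∘ (_∷ʳ U)) (words (suc k))
    ℕ.+ (count (P? ∘ (_∷ʳ D)) (words (suc k)) ℕ.+ count (P? ∘ (_∷ʳ H)) (words k)) ∎
  where
  open ≡-Reasoning
  both : Step → Step → List (List Step) → ℕ
  both s t = count (λ w → P? (s ∷ w ∷ʳ t))
  uu = both U U (words k)
  ud = both U D (words k)
  du = both D U (words k)
  dd = both D D (words k)
  uh = both U H (words⁻ k)
  dh = both D H (words⁻ k)
  hu = both H U (words⁻ k)
  hd = both H D (words⁻ k)
  regroup : ∀ uu ud uh du dd dh h → (uu ℕ.+ (ud ℕ.+ uh)) ℕ.+ ((du ℕ.+ (dd ℕ.+ dh)) ℕ.+ h) ≡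
                                    uu ℕ.+ du ℕ.+ (ud ℕ.+ dd) ℕ.+ (h ℕ.+ (uh ℕ.+ dh))
  regroup = ℕ-Solver.solve-∀
  ungroup : ∀ uu ud hu du dd hd h → uu ℕ.+ du ℕ.+ (ud ℕ.+ dd) ℕ.+ (h ℕ.+ (hu ℕ.+ hd)) ≡
                                    (uu ℕ.+ (du ℕ.+ hu)) ℕ.+ ((ud ℕ.+ (dd ℕ.+ hd)) ℕ.+ h)
  ungroup = ℕ-Solver.solve-∀
  rotate : ∀ a b c d e → (a ℕ.+ (b ℕ.+ c)) ℕ.+ (d ℕ.+ e) ≡ (d ℕ.+ (e ℕ.+ c)) ℕ.+ (a ℕ.+ b)
  rotate = ℕ-Solver.solve-∀
  -- Words that have H at the first or last place.  For k = 0 the word H alone is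
  -- counted on both sides.
  edge : ∀ k →
    count (P? ∘ (H ∷_)) (words k) ℕ.+ (both U H (words⁻ k) ℕ.+ both D H (words⁻ k)) ≡
    count (P? ∘ (_∷ʳ H)) (words k) ℕ.+ (both H U (words⁻ k) ℕ.+ both H D (words⁻ k))
  edge zero    = cong (ℕ._+ 0) (count-singleton (P? ∘ (H ∷_)) (P? ∘ (_∷ʳ H)) [] refl)
  edge (suc k) = begin
    count (P? ∘ (H ∷_)) (words (suc k)) ℕ.+ (both U H (words k) ℕ.+ both D H (words k))
      ≡⟨ cong (ℕ._+ (both U H (words k) ℕ.+ both D H (words k))) (count-last k (P? ∘ (H ∷_))) ⟩
    (both H U (words k) ℕ.+ (both H D (words k) ℕ.+ both H H (words⁻ k)))
      ℕ.+ (both U H (words k) ℕ.+ both D H (words k))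
      ≡⟨ rotate (both H U (words k)) (both H D (words k)) (both H H (words⁻ k))
           (both U H (words k)) (both D H (words k)) ⟩
    (both U H (words k) ℕ.+ (both D H (words k) ℕ.+ both H H (words⁻ k)))
      ℕ.+ (both H U (words k) ℕ.+ both H D (words k))
      ≡⟨ cong (ℕ._+ (both H U (words k) ℕ.+ both H D (words k))) (count-first k (P? ∘ (_∷ʳ H))) ⟨
    count (P? ∘ (_∷ʳ H)) (words (suc k)) ℕ.+ (both H U (words k) ℕ.+ both H D (words k)) ∎

endpoint-∷ʳ : ∀ m p w s → endpoint m p (w ∷ʳ s) ≡ move m s (endpoint m p w)
endpoint-∷ʳ m p []      s = refl
endpoint-∷ʳ m p (t ∷ w) s = endpoint-∷ʳ m (move m t p) w s

trace-∷ʳ : ∀ m p w s → trace m p (w ∷ʳ s) ≡ trace m p w ∷ʳ (s , move m s (endpoint m p w))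
trace-∷ʳ m p []      s = refl
trace-∷ʳ m p (t ∷ w) s = cong (_ ∷_) (trace-∷ʳ m (move m t p) w s)

move-injective : ∀ m s p q → move m s p ≡ move m s q → p ≡ q
move-injective m s p q eq = cong₂ _,_
  (+-cancelʳ (+ dx s) (proj₁ p) (proj₁ q) (cong proj₁ eq))
  (+-cancelʳ (dy m s) (proj₂ p) (proj₂ q) (cong proj₂ eq))

-- The vertex does not lie below the axis.
NonNegative : Step × Point → Set
NonNegative (_ , _ , y) = 0ℤ ℤ.≤ y

-- The vertex is not the end of an H step on the axis.
NotGrounded : Step × Point → Set
NotGrounded (s , _ , y) = ¬ (s ≡ H × y ≡ 0ℤ)

-- The word w, started at the origin with m = 3, satisfies the vertex conditions of a
-- small path and ends at p; the end may lie above the axis.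
IsPrefix : Point → List Step → Set
IsPrefix p w =
  (endpoint 3 origin w ≡ p × All NonNegative (trace 3 origin w)) ×
  All NotGrounded (trace 3 origin w)

isPrefix? : ∀ p → Decidable (IsPrefix p)
isPrefix? p w =
  (≡-dec ℤ._≟_ ℤ._≟_ _ _ ×-dec All.all? (λ (_ , _ , y) → 0ℤ ℤ.≤? y) _) ×-dec
  All.all? (λ (s , _ , y) → ¬? ((s ≟ˢ H) ×-dec (y ℤ.≟ 0ℤ))) _

endpoint-nonNegative : ∀ p w → 0ℤ ℤ.≤ proj₂ p → All NonNegative (trace 3 p w) →
                       0ℤ ℤ.≤ proj₂ (endpoint 3 p w)
endpoint-nonNegative p []      0≤y []       = 0≤y
endpoint-nonNegative p (s ∷ w) 0≤y (0≤ ∷ a) = endpoint-nonNegative (move 3 s p) w 0≤ a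

-- What a prefix that ends with the step s says about the prefix without this step.
isPrefix-∷ʳ⁻ : ∀ s q w → IsPrefix q (w ∷ʳ s) →
  IsPrefix (endpoint 3 origin w) w × move 3 s (endpoint 3 origin w) ≡ q × NotGrounded (s , q)
isPrefix-∷ʳ⁻ s q w ((e , a) , b) with trans (sym (endpoint-∷ʳ 3 origin w s)) e
... | refl with ∷ʳ⁻ (subst (All NonNegative) (trace-∷ʳ 3 origin w s) a)
              | ∷ʳ⁻ (subst (All NotGrounded) (trace-∷ʳ 3 origin w s) b)
... | a′ , _ | b′ , last = ((refl , a′) , b′) , refl , last

isPrefix-∷ʳ : ∀ s p {q} → move 3 s p ≡ q → NonNegative (s , q) → NotGrounded (s , q) →
              ∀ w → IsPrefix q (w ∷ʳ s) ⇔ IsPrefix p w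
isPrefix-∷ʳ s p refl 0≤ ng w = mk⇔ to from
  where
  to : IsPrefix (move 3 s p) (w ∷ʳ s) → IsPrefix p w
  to pre with isPrefix-∷ʳ⁻ s (move 3 s p) w pre
  ... | pre′ , eq , _ = subst (λ r → IsPrefix r w) (move-injective 3 s _ p eq) pre′
  from : IsPrefix p w → IsPrefix (move 3 s p) (w ∷ʳ s)
  from ((refl , a) , b) =
    (endpoint-∷ʳ 3 origin w s , subst (All NonNegative) (sym (trace-∷ʳ 3 origin w s)) (∷ʳ⁺ a 0≤)) ,
    subst (All NotGrounded) (sym (trace-∷ʳ 3 origin w s)) (∷ʳ⁺ b ng)

-- The number of prefixes of small 3-Schröder paths that end at the point (k , h).
prefixes : ℕ → ℕ → ℕ
prefixes k h = count (isPrefix? (+ k , + h)) (words k)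

-- As prefixes, with horizontal length k - 1.
prefixes⁻ : ℕ → ℕ → ℕ
prefixes⁻ zero    h = 0
prefixes⁻ (suc k) h = prefixes k h

-- The prefixes that end at a given point, by their last step.
last-U-suc : ∀ k h → count (isPrefix? (+ suc k , + suc h) ∘ (_∷ʳ U)) (words k) ≡ prefixes k h
last-U-suc k h = count-⇔ (isPrefix? (+ suc k , + suc h) ∘ (_∷ʳ U)) (isPrefix? (+ k , + h))
  (isPrefix-∷ʳ U (+ k , + h) (cong₂ (λ a b → + a , + b) (ℕ.+-comm k 1) (ℕ.+-comm h 1))
    (ℤ.+≤+ ℕ.z≤n) (λ ()))
  (words k)

last-U-0 : ∀ k → count (isPrefix? (+ suc k , 0ℤ) ∘ (_∷ʳ U)) (words k) ≡ 0
last-U-0 k = count-none (isPrefix? (+ suc k , 0ℤ) ∘ (_∷ʳ U)) impossible (words k)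
  where
  0≤y⇒y+1≢0 : ∀ {y} → 0ℤ ℤ.≤ y → y ℤ.+ 1ℤ ≢ 0ℤ
  0≤y⇒y+1≢0 {+ n} _ eq with trans (ℕ.+-comm 1 n) (ℤ.+-injective eq)
  ... | ()
  impossible : ∀ w → ¬ IsPrefix (+ suc k , 0ℤ) (w ∷ʳ U)
  impossible w pre with isPrefix-∷ʳ⁻ U (+ suc k , 0ℤ) w pre
  ... | ((_ , a) , _) , eq , _ =
    0≤y⇒y+1≢0 (endpoint-nonNegative origin w ℤ.≤-refl a) (cong proj₂ eq)

last-D : ∀ k h → count (isPrefix? (+ suc k , + h) ∘ (_∷ʳ D)) (words k) ≡ prefixes k (2 ℕ.+ h)
last-D k h = count-⇔ (isPrefix? (+ suc k , + h) ∘ (_∷ʳ D)) (isPrefix? (+ k , + (2 ℕ.+ h)))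
  (isPrefix-∷ʳ D (+ k , + (2 ℕ.+ h)) (cong (λ a → + a , + h) (ℕ.+-comm k 1))
    (ℤ.+≤+ ℕ.z≤n) (λ ()))
  (words k)

last-H-suc : ∀ k h →
  count (isPrefix? (+ suc k , + suc h) ∘ (_∷ʳ H)) (words⁻ k) ≡ prefixes⁻ k (2 ℕ.+ h)
last-H-suc zero    h = refl
last-H-suc (suc k) h =
  count-⇔ (isPrefix? (+ suc (suc k) , + suc h) ∘ (_∷ʳ H)) (isPrefix? (+ k , + (2 ℕ.+ h)))
    (isPrefix-∷ʳ H (+ k , + (2 ℕ.+ h)) (cong (λ a → + a , + suc h) (ℕ.+-comm k 2))
      (ℤ.+≤+ ℕ.z≤n) (λ ()))
    (words k)

last-H-0 : ∀ k → count (isPrefix? (+ suc k , 0ℤ) ∘ (_∷ʳ H)) (words⁻ k) ≡ 0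
last-H-0 k = count-none (isPrefix? (+ suc k , 0ℤ) ∘ (_∷ʳ H)) impossible (words⁻ k)
  where
  impossible : ∀ w → ¬ IsPrefix (+ suc k , 0ℤ) (w ∷ʳ H)
  impossible w pre with isPrefix-∷ʳ⁻ H (+ suc k , 0ℤ) w pre
  ... | _ , _ , ng = ng (refl , refl)

-- A small path that returns to the axis does so with a D step.
prefixes-suc-0 : ∀ k → prefixes (suc k) 0 ≡ prefixes k 2
prefixes-suc-0 k = begin
  prefixes (suc k) 0           ≡⟨ count-last k (isPrefix? (+ suc k , 0ℤ)) ⟩
  _                            ≡⟨ cong₂ ℕ._+_ (last-U-0 k) (cong₂ ℕ._+_ (last-D k 0) (last-H-0 k)) ⟩
  prefixes k 2 ℕ.+ 0           ≡⟨ ℕ.+-identityʳ (prefixes k 2) ⟩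
  prefixes k 2                 ∎
  where open ≡-Reasoning

prefixes-suc-suc : ∀ k h →
  prefixes (suc k) (suc h) ≡ prefixes k h ℕ.+ (prefixes k (3 ℕ.+ h) ℕ.+ prefixes⁻ k (2 ℕ.+ h))
prefixes-suc-suc k h = trans (count-last k (isPrefix? (+ suc k , + suc h)))
  (cong₂ ℕ._+_ (last-U-suc k h) (cong₂ ℕ._+_ (last-D k (suc h)) (last-H-suc k h)))

-- Each step rises by at most its horizontal length.
prefixes-high : ∀ {k h} → k ℕ.< h → prefixes k h ≡ 0
prefixes-high {zero}        {suc h} _         = refl
prefixes-high {suc zero}    {suc h} (s≤s 0<h) = trans (prefixes-suc-suc 0 h)
  (cong (ℕ._+ 0) (prefixes-high 0<h))
prefixes-high {suc (suc k)} {suc h} (s≤s k<h) = trans (prefixes-suc-suc (suc k) h)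
  (cong₂ ℕ._+_ (prefixes-high k<h) (cong₂ ℕ._+_
    (prefixes-high (ℕ.m≤n⇒m≤o+n 3 k<h))
    (prefixes-high (ℕ.m≤n⇒m≤o+n 2 (ℕ.<-trans (ℕ.n<1+n k) k<h)))))

smallSchröder≡prefixes : ∀ n → smallSchröder 3 n ≡ prefixes (3 ℕ.* n) 0
smallSchröder≡prefixes n = count-⇔ (isSmallSchröderPath? 3 n) (isPrefix? (+ (3 ℕ.* n) , 0ℤ))
  (λ w → mk⇔ (λ s → s) (λ s → s)) (words (3 ℕ.* n))

-- The generating functions of small prefixes

1+y : Series
1+y = const 1ℤ ⊕ y

-- (1 + y)² (2 + y).
G : Series
G = 1+y ^ˢ 2 ⊛ (1+y ⊕ const 1ℤ)

-- (2 + y) (1 + y)ʰ: with y(t) = t G(y(t)), substituting y(t) gives twice the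
-- generating function of the prefixes of height h, by number of descending steps.
F : ℕ → Series
F h = (1+y ⊕ const 1ℤ) ⊛ 1+y ^ˢ h

-- With G-F this mirrors the recursion for prefixes by their last step: U, D and H
-- lead to height h + 1 from the heights h, h + 3 and h + 2.
F-suc : ∀ h → F (suc h) ≈ F h ⊕ y ⊛ F h
F-suc h = Solver.solve 2
  (λ y rʰ → (con 1 :+ y :+ con 1) :* ((con 1 :+ y) :* rʰ) :=
            (con 1 :+ y :+ con 1) :* rʰ :+ y :* ((con 1 :+ y :+ con 1) :* rʰ))
  (λ _ → refl) y (1+y ^ˢ h)

G-F : ∀ h → G ⊛ F h ≈ F (3 ℕ.+ h) ⊕ F (2 ℕ.+ h)
G-F h = Solver.solve 2
  (λ r rʰ → (r :* (r :* con 1)) :* (r :+ con 1) :* ((r :+ con 1) :* rʰ) :=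
            (r :+ con 1) :* (r :* (r :* (r :* rʰ))) :+ (r :+ con 1) :* (r :* (r :* rʰ)))
  (λ _ → refl) 1+y (1+y ^ˢ h)

-- The horizontal length 3 n + h of a prefix of height h that has n steps of type D
-- or H.  Trading such a step for three units of height leaves it unchanged.
pathWidth : ℕ → ℕ → ℕ
pathWidth zero    h = h
pathWidth (suc n) h = pathWidth n (3 ℕ.+ h)

pathWidth-suc : ∀ n h → pathWidth n (suc h) ≡ suc (pathWidth n h)
pathWidth-suc zero    h = refl
pathWidth-suc (suc n) h = pathWidth-suc n (3 ℕ.+ h)

pathWidth-* : ∀ n h → pathWidth n h ≡ 3 ℕ.* n ℕ.+ h
pathWidth-* zero    h = refl
pathWidth-* (suc n) h = trans (pathWidth-* n (3 ℕ.+ h)) (lemma n h)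
  where
  lemma : ∀ n h → 3 ℕ.* n ℕ.+ (3 ℕ.+ h) ≡ 3 ℕ.* (1 ℕ.+ n) ℕ.+ h
  lemma = ℕ-Solver.solve-∀

-- F 0 = 2 + y, and the constant 2 contributes nothing in positive degree.
A-F-0 : ∀ n → A G (suc n) (F 0) ≡ A G (suc n) y
A-F-0 n = begin
  A G (suc n) (F 0)
    ≡⟨ A-cong G (suc n) (Solver.solve 1
         (λ y → (con 1 :+ y :+ con 1) :* con 1 := con 1 :+ (con 1 :+ y)) (λ _ → refl) y) ⟩
  A G (suc n) (𝟏 ⊕ (𝟏 ⊕ y))
    ≡⟨ A-⊕ G (suc n) 𝟏 (𝟏 ⊕ y) ⟩
  A G (suc n) 𝟏 + A G (suc n) (𝟏 ⊕ y)
    ≡⟨ cong₂ _+_ (A-1 G n) (trans (A-⊕ G (suc n) 𝟏 y) (cong (_+ A G (suc n) y) (A-1 G n))) ⟩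
  0ℤ + (0ℤ + A G (suc n) y)
    ≡⟨ trans (ℤ.+-identityˡ _) (ℤ.+-identityˡ _) ⟩
  A G (suc n) y ∎
  where
  open ≡-Reasoning
  𝟏 : Series
  𝟏 = const 1ℤ

A-y-F2 : ∀ n → A G (suc n) y ≡ A G n (F 2)
A-y-F2 n = begin
  A G (suc n) y             ≡⟨ A-cong G (suc n) (S.*-identityʳ y) ⟨
  A G (suc n) (y ⊛ S.1#)    ≡⟨ A-y G n S.1# ⟩
  A G n (G ⊛ S.1#)          ≡⟨ A-cong G n (Solver.solve 1
                                 (λ r → (r :* (r :* con 1)) :* (r :+ con 1) :* con 1 :=
                                        (r :+ con 1) :* (r :* (r :* con 1)))
                                 (λ _ → refl) 1+y) ⟩
  A G n (F 2)               ∎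
  where open ≡-Reasoning

A-F-suc : ∀ n h → A G (suc n) (F (suc h)) ≡
          A G (suc n) (F h) + (A G n (F (3 ℕ.+ h)) + A G n (F (2 ℕ.+ h)))
A-F-suc n h = begin
  A G (suc n) (F (suc h))                        ≡⟨ A-cong G (suc n) (F-suc h) ⟩
  A G (suc n) (F h ⊕ y ⊛ F h)                    ≡⟨ A-⊕ G (suc n) (F h) (y ⊛ F h) ⟩
  A G (suc n) (F h) + A G (suc n) (y ⊛ F h)      ≡⟨ cong (λ z → A G (suc n) (F h) + z) (begin
    A G (suc n) (y ⊛ F h)                          ≡⟨ A-y G n (F h) ⟩
    A G n (G ⊛ F h)                                ≡⟨ A-cong G n (G-F h) ⟩
    A G n (F (3 ℕ.+ h) ⊕ F (2 ℕ.+ h))              ≡⟨ A-⊕ G n (F (3 ℕ.+ h)) (F (2 ℕ.+ h)) ⟩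
    A G n (F (3 ℕ.+ h)) + A G n (F (2 ℕ.+ h))      ∎) ⟩
  A G (suc n) (F h) + (A G n (F (3 ℕ.+ h)) + A G n (F (2 ℕ.+ h))) ∎
  where open ≡-Reasoning

-- Only the word that consists of U steps rises by its full length.
prefixes-diagonal : ∀ h → prefixes h h ≡ 1
prefixes-diagonal zero    = refl
prefixes-diagonal (suc h) = trans (prefixes-suc-suc h h)
  (cong₂ ℕ._+_ (prefixes-diagonal h)
    (cong₂ ℕ._+_ (prefixes-high (ℕ.m≤n+m (suc h) 2)) (none h)))
  where
  none : ∀ h → prefixes⁻ h (2 ℕ.+ h) ≡ 0
  none zero    = refl
  none (suc h) = prefixes-high (ℕ.m≤n+m (suc h) 2)

F-constant : ∀ h → F h 0 ≡ + 2
F-constant zero    = refl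
F-constant (suc h) = trans (F-suc h 0) (trans (ℤ.+-identityʳ (F h 0)) (F-constant h))

2*prefixes : ∀ n h → + 2 * + prefixes (pathWidth n h) h ≡ A G n (F h)
2*prefixes zero    h       = trans (cong (λ p → + 2 * + p) (prefixes-diagonal h)) (sym (F-constant h))
2*prefixes (suc n) zero    = begin
  + 2 * + prefixes (pathWidth n 3) 0          ≡⟨ cong (λ k → + 2 * + prefixes k 0) (pathWidth-suc n 2) ⟩
  + 2 * + prefixes (suc (pathWidth n 2)) 0    ≡⟨ cong (λ p → + 2 * + p) (prefixes-suc-0 (pathWidth n 2)) ⟩
  + 2 * + prefixes (pathWidth n 2) 2          ≡⟨ 2*prefixes n 2 ⟩
  A G n (F 2)                                 ≡⟨ A-y-F2 n ⟨
  A G (suc n) y                               ≡⟨ A-F-0 n ⟨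
  A G (suc n) (F 0)                           ∎
  where open ≡-Reasoning
2*prefixes (suc n) (suc h) = begin
  + 2 * + prefixes (pathWidth n (4 ℕ.+ h)) (suc h)
    ≡⟨ cong (λ p → + 2 * + p) split ⟩
  + 2 * (+ u + (+ d + + e))
    ≡⟨ distrib (+ u) (+ d) (+ e) ⟩
  + 2 * + u + (+ 2 * + d + + 2 * + e)
    ≡⟨ cong₂ _+_ (2*prefixes (suc n) h)
         (cong₂ _+_ (2*prefixes n (3 ℕ.+ h)) (2*prefixes n (2 ℕ.+ h))) ⟩
  A G (suc n) (F h) + (A G n (F (3 ℕ.+ h)) + A G n (F (2 ℕ.+ h)))
    ≡⟨ A-F-suc n h ⟨
  A G (suc n) (F (suc h)) ∎
  where
  open ≡-Reasoning
  u d e : ℕ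
  u = prefixes (pathWidth (suc n) h) h
  d = prefixes (pathWidth n (3 ℕ.+ h)) (3 ℕ.+ h)
  e = prefixes (pathWidth n (2 ℕ.+ h)) (2 ℕ.+ h)
  distrib : ∀ a b c → + 2 * (a + (b + c)) ≡ + 2 * a + (+ 2 * b + + 2 * c)
  distrib = solve-∀
  split : prefixes (pathWidth n (4 ℕ.+ h)) (suc h) ≡ u ℕ.+ (d ℕ.+ e)
  split = begin
    prefixes (pathWidth n (4 ℕ.+ h)) (suc h)
      ≡⟨ cong (λ k → prefixes k (suc h)) (pathWidth-suc n (3 ℕ.+ h)) ⟩
    prefixes (suc (pathWidth n (3 ℕ.+ h))) (suc h)
      ≡⟨ prefixes-suc-suc (pathWidth n (3 ℕ.+ h)) h ⟩
    u ℕ.+ (d ℕ.+ prefixes⁻ (pathWidth n (3 ℕ.+ h)) (2 ℕ.+ h))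
      ≡⟨ cong (λ k → u ℕ.+ (d ℕ.+ prefixes⁻ k (2 ℕ.+ h))) (pathWidth-suc n (2 ℕ.+ h)) ⟩
    u ℕ.+ (d ℕ.+ e) ∎

-- 2 (n + 1) s = [yⁿ] Gⁿ⁺¹ for the small Schröder number s of index n + 1.
smallSchröder-coefficient : ∀ n →
  + suc n * (+ 2 * + smallSchröder 3 (suc n)) ≡ (G ^ˢ suc n) n
smallSchröder-coefficient n = begin
  + suc n * (+ 2 * + smallSchröder 3 (suc n))
    ≡⟨ cong (λ s → + suc n * (+ 2 * + s)) (smallSchröder≡prefixes (suc n)) ⟩
  + suc n * (+ 2 * + prefixes (3 ℕ.* suc n) 0)
    ≡⟨ cong (λ k → + suc n * (+ 2 * + prefixes k 0))
         (trans (pathWidth-* (suc n) 0) (ℕ.+-identityʳ (3 ℕ.* suc n))) ⟨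
  + suc n * (+ 2 * + prefixes (pathWidth (suc n) 0) 0)
    ≡⟨ cong (+ suc n *_) (2*prefixes (suc n) 0) ⟩
  + suc n * A G (suc n) (F 0)
    ≡⟨ cong (+ suc n *_) (A-F-0 n) ⟩
  + suc n * A G (suc n) y
    ≡⟨ lagrange G n ⟩
  (G ^ˢ suc n) n ∎
  where open ≡-Reasoning

-- Coefficients of the powers of G

1+y-power : ∀ m n → (1+y ^ˢ m) n ≡ + (m C n)
1+y-power zero    zero    = refl
1+y-power zero    (suc n) = refl
1+y-power (suc m) n = trans (expand n) (pascal n)
  where
  expand : 1+y ^ˢ suc m ≈ 1+y ^ˢ m ⊕ y ⊛ 1+y ^ˢ m
  expand = Solver.solve 2 (λ y rᵐ → (con 1 :+ y) :* rᵐ := rᵐ :+ y :* rᵐ) (λ _ → refl) y (1+y ^ˢ m)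
  pascal : ∀ n → (1+y ^ˢ m ⊕ y ⊛ 1+y ^ˢ m) n ≡ + (suc m C n)
  pascal zero    = trans (ℤ.+-identityʳ _) (1+y-power m 0)
  pascal (suc n) = begin
    (1+y ^ˢ m) (suc n) + (y ⊛ 1+y ^ˢ m) (suc n)
      ≡⟨ cong₂ _+_ (1+y-power m (suc n)) (trans (y-⊛ (1+y ^ˢ m) n) (1+y-power m n)) ⟩
    + (m C suc n ℕ.+ m C n)
      ≡⟨ cong +_ (ℕ.+-comm (m C suc n) (m C n)) ⟩
    + (m C n ℕ.+ m C suc n)
      ≡⟨ cong +_ (nCk+nC[k+1]≡[n+1]C[k+1] m n) ⟩
    + (suc m C suc n) ∎
    where open ≡-Reasoning

sum-coefficient : ∀ {k} (t : Fin k → Series) n → Sˢ.sum t n ≡ sum (λ i → t i n)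
sum-coefficient {zero}  t n = refl
sum-coefficient {suc k} t n = cong (λ z → t zero n + z) (sum-coefficient (λ i → t (suc i)) n)

×-coefficient : ∀ c f n → (c ×ˢ f) n ≡ + c * f n
×-coefficient zero    f n = refl
×-coefficient (suc c) f n = trans (cong (λ z → f n + z) (×-coefficient c f n)) (lemma (+ c) (f n))
  where
  lemma : ∀ c a → a + c * a ≡ (1ℤ + c) * a
  lemma = solve-∀

const-power : ∀ c k → const c ^ˢ k ≈ const (c ^ k)
const-power c zero    n = refl
const-power c (suc k) n = trans (const-⊛ c (const c ^ˢ k) n)
  (trans (cong (c *_) (const-power c k n)) (lemma n))
  where
  lemma : ∀ n → c * const (c ^ k) n ≡ const (c ^ suc k) n
  lemma zero    = refl
  lemma (suc n) = ℤ.*-zeroʳ c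

-- Expand (1 + y)²ⁱ (1 + (1 + y))ⁱ in powers of 1 + y.
G-power : ∀ i n → (G ^ˢ i) n ≡ ∑[ j ≤ i ] (+ (i C toℕ j) * + ((2 ℕ.* i ℕ.+ toℕ j) C n))
G-power i n = begin
  (G ^ˢ i) n
    ≡⟨ expand n ⟩
  Sˢ.sum term n
    ≡⟨ sum-coefficient term n ⟩
  sum (λ j → term j n)
    ≡⟨ sum-cong-≗ term-coefficient ⟩
  ∑[ j ≤ i ] (+ (i C toℕ j) * + ((2 ℕ.* i ℕ.+ toℕ j) C n)) ∎
  where
  open ≡-Reasoning
  term : Fin (suc i) → Series
  term j = 1+y ^ˢ (2 ℕ.* i) ⊛ Binomial.binomialTerm 1+y S.1# i j

  expand : G ^ˢ i ≈ Sˢ.sum term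
  expand = S.trans (^-distrib-* (1+y ^ˢ 2) (1+y ⊕ S.1#) i)
    (S.trans (S.*-cong (^-assocʳ 1+y 2 i) (Binomial.theorem i 1+y S.1#))
      (*-distribˡ-sumˢ (1+y ^ˢ (2 ℕ.* i)) (Binomial.binomialTerm 1+y S.1# i)))

  term-coefficient : ∀ j → term j n ≡ + (i C toℕ j) * + ((2 ℕ.* i ℕ.+ toℕ j) C n)
  term-coefficient j = begin
    (1+y ^ˢ (2 ℕ.* i) ⊛ ((i C toℕ j) ×ˢ (1+y ^ˢ toℕ j ⊛ S.1# ^ˢ (i ∸ toℕ j)))) n
      ≡⟨ ×-comm-* (i C toℕ j) (1+y ^ˢ (2 ℕ.* i)) _ n ⟩
    ((i C toℕ j) ×ˢ (1+y ^ˢ (2 ℕ.* i) ⊛ (1+y ^ˢ toℕ j ⊛ S.1# ^ˢ (i ∸ toℕ j)))) n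
      ≡⟨ ×-coefficient (i C toℕ j) _ n ⟩
    + (i C toℕ j) * (1+y ^ˢ (2 ℕ.* i) ⊛ (1+y ^ˢ toℕ j ⊛ S.1# ^ˢ (i ∸ toℕ j))) n
      ≡⟨ cong (+ (i C toℕ j) *_) (merge n) ⟩
    + (i C toℕ j) * (1+y ^ˢ (2 ℕ.* i ℕ.+ toℕ j)) n
      ≡⟨ cong (+ (i C toℕ j) *_) (1+y-power (2 ℕ.* i ℕ.+ toℕ j) n) ⟩
    + (i C toℕ j) * + ((2 ℕ.* i ℕ.+ toℕ j) C n) ∎
    where
    one-power : ∀ k → S.1# ^ˢ k ≈ S.1#
    one-power k n = trans (const-power 1ℤ k n) (cong (λ c → const c n) (ℤ.^-zeroˡ k))
    merge : 1+y ^ˢ (2 ℕ.* i) ⊛ (1+y ^ˢ toℕ j ⊛ S.1# ^ˢ (i ∸ toℕ j)) ≈ 1+y ^ˢ (2 ℕ.* i ℕ.+ toℕ j)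
    merge = S.trans
      (S.*-congˡ {1+y ^ˢ (2 ℕ.* i)}
        (S.trans (S.*-congˡ {1+y ^ˢ toℕ j} (one-power (i ∸ toℕ j))) (S.*-identityʳ (1+y ^ˢ toℕ j))))
      (S.sym (^-homo-* 1+y (2 ℕ.* i) (toℕ j)))

-- The m-th power of a series without constant term is divisible by yᵐ.
power-vanish : ∀ f → f 0 ≡ 0ℤ → ∀ {m n} → n ℕ.< m → (f ^ˢ m) n ≡ 0ℤ
power-vanish f f0≡0 {suc m} {n} n<m = go n n<m
  where
  below : ∀ h n → n ℕ.< m → (h ⊛ f ^ˢ m) n ≡ 0ℤ
  below h zero    n<m = trans (cong (h 0 *_) (power-vanish f f0≡0 n<m)) (ℤ.*-zeroʳ (h 0))
  below h (suc n) n<m = cong₂ _+_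
    (trans (cong (h 0 *_) (power-vanish f f0≡0 n<m)) (ℤ.*-zeroʳ (h 0)))
    (below (tail h) n (ℕ.<-trans (ℕ.n<1+n n) n<m))
  go : ∀ n → n ℕ.< suc m → (f ⊛ f ^ˢ m) n ≡ 0ℤ
  go zero    _           = cong (_* (f ^ˢ m) 0) f0≡0
  go (suc n) (ℕ.s≤s n<m) = cong₂ _+_ (cong (_* (f ^ˢ m) (suc n)) f0≡0) (below (tail f) n n<m)

shifted-power : ∀ f c N n →
  ((f ⊕ const c) ^ˢ N) n ≡ ∑[ i ≤ N ] (+ (N C toℕ i) * (c ^ (N ∸ toℕ i) * (f ^ˢ toℕ i) n))
shifted-power f c N n = begin
  ((f ⊕ const c) ^ˢ N) n                ≡⟨ Binomial.theorem N f (const c) n ⟩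
  Sˢ.sum term n                         ≡⟨ sum-coefficient term n ⟩
  sum (λ i → term i n)                  ≡⟨ sum-cong-≗ {suc N} {λ i → term i n} {coefficient} term-coefficient ⟩
  sum coefficient                       ∎
  where
  open ≡-Reasoning
  term : Fin (suc N) → Series
  term = Binomial.binomialTerm f (const c) N
  coefficient : Fin (suc N) → ℤ
  coefficient i = + (N C toℕ i) * (c ^ (N ∸ toℕ i) * (f ^ˢ toℕ i) n)
  pull : ∀ i → (f ^ˢ i ⊛ const c ^ˢ (N ∸ i)) n ≡ c ^ (N ∸ i) * (f ^ˢ i) n
  pull i = trans (⊛-comm (f ^ˢ i) (const c ^ˢ (N ∸ i)) n)
    (trans (⊛-cong {g = f ^ˢ i} (const-power c (N ∸ i)) (λ _ → refl) n)
           (const-⊛ (c ^ (N ∸ i)) (f ^ˢ i) n))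
  term-coefficient : ∀ i → term i n ≡ coefficient i
  term-coefficient i = trans
    (×-coefficient (N C toℕ i) (f ^ˢ toℕ i ⊛ const c ^ˢ (N ∸ toℕ i)) n)
    (cong (+ (N C toℕ i) *_) (pull (toℕ i)))

-- The i-th term of the outer sum in the formula.
summand : ∀ n → Fin (suc n) → ℤ
summand n i =
  (- (+ 2)) ^ (n ∸ toℕ i) * + (suc n C toℕ i) *
  (∑[ j ≤ toℕ i ] (+ (toℕ i C toℕ j) * + ((2 ℕ.* toℕ i ℕ.+ toℕ j) C n)))

-- G - 2 has no constant term, so the coefficient of yⁿ in (G - 2)ⁿ⁺¹ is zero.
-- In its binomial expansion the term Gⁿ⁺¹ balances all the lower ones.
top-power : ∀ n → (G ^ˢ suc n) n ≡ + 2 * sum (summand n)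
top-power n = ℤ.i-j≡0⇒i≡j ((G ^ˢ N) n) (+ 2 * sum (summand n)) (begin
  (G ^ˢ N) n + - (+ 2 * sum (summand n))
    ≡⟨ rearrange ((G ^ˢ N) n) (sum (summand n)) ⟩
  - (+ 2) * sum (summand n) + (G ^ˢ N) n
    ≡⟨ cong₂ _+_ (*-distribˡ-sum (- (+ 2)) (summand n)) (sym highest) ⟩
  sum (λ i → - (+ 2) * summand n i) + full (fromℕ N)
    ≡⟨ cong (_+ full (fromℕ N)) (sum-cong-≗ {N} {λ i → full (inject₁ i)} {λ i → - (+ 2) * summand n i} lower) ⟨
  sum (λ i → full (inject₁ i)) + full (fromℕ N)
    ≡⟨ sum-init-last full ⟨
  sum full
    ≡⟨ shifted-power G (- (+ 2)) N n ⟨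
  ((G ⊕ const (- (+ 2))) ^ˢ N) n
    ≡⟨ power-vanish (G ⊕ const (- (+ 2))) refl (ℕ.n<1+n n) ⟩
  0ℤ ∎)
  where
  open ≡-Reasoning
  N : ℕ
  N = suc n
  term : ℕ → ℤ
  term i = + (N C i) * ((- (+ 2)) ^ (N ∸ i) * (G ^ˢ i) n)
  full : Fin (suc N) → ℤ
  full i = term (toℕ i)
  rearrange : ∀ a b → a + - (+ 2 * b) ≡ - (+ 2) * b + a
  rearrange = solve-∀
  highest : full (fromℕ N) ≡ (G ^ˢ N) n
  highest = begin
    term (toℕ (fromℕ N))
      ≡⟨ cong term (toℕ-fromℕ N) ⟩
    + (N C N) * ((- (+ 2)) ^ (N ∸ N) * (G ^ˢ N) n)
      ≡⟨ cong₂ (λ b k → + b * ((- (+ 2)) ^ k * (G ^ˢ N) n)) (nCn≡1 N) (ℕ.n∸n≡0 N) ⟩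
    1ℤ * (1ℤ * (G ^ˢ N) n)
      ≡⟨ trans (ℤ.*-identityˡ (1ℤ * (G ^ˢ N) n)) (ℤ.*-identityˡ ((G ^ˢ N) n)) ⟩
    (G ^ˢ N) n ∎
  inner : ℕ → ℤ
  inner i = ∑[ j ≤ i ] (+ (i C toℕ j) * + ((2 ℕ.* i ℕ.+ toℕ j) C n))
  swap : ∀ t p b g → b * (t * p * g) ≡ t * (p * b * g)
  swap = solve-∀
  lower : ∀ i → full (inject₁ i) ≡ - (+ 2) * summand n i
  lower i = begin
    term (toℕ (inject₁ i))
      ≡⟨ cong term (toℕ-inject₁ i) ⟩
    + (N C toℕ i) * ((- (+ 2)) ^ (N ∸ toℕ i) * (G ^ˢ toℕ i) n)
      ≡⟨ cong₂ (λ k g → + (N C toℕ i) * ((- (+ 2)) ^ k * g))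
           (ℕ.+-∸-assoc 1 (toℕ≤pred[n] i)) (G-power (toℕ i) n) ⟩
    + (N C toℕ i) * (- (+ 2) * (- (+ 2)) ^ (n ∸ toℕ i) * inner (toℕ i))
      ≡⟨ swap (- (+ 2)) ((- (+ 2)) ^ (n ∸ toℕ i)) (+ (N C toℕ i)) (inner (toℕ i)) ⟩
    - (+ 2) * summand n i ∎

-- The formula

divide : ∀ n {s t} → + suc n * s ≡ t → s / 1 ≡ (1ℤ / suc n) ℚ.* (t / 1)
divide n {s} {t} eq = ℚ.toℚᵘ-injective (begin
  ℚ.toℚᵘ (s / 1)                              ≈⟨ ℚ.toℚᵘ-fromℚᵘ (ℚᵘ.mkℚᵘ s 0) ⟩
  ℚᵘ.mkℚᵘ s 0                                 ≈⟨ ℚᵘ.*≡* cross ⟩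
  ℚᵘ.mkℚᵘ 1ℤ n ℚᵘ.* ℚᵘ.mkℚᵘ t 0               ≈⟨ ℚᵘ.*-cong (ℚ.toℚᵘ-fromℚᵘ (ℚᵘ.mkℚᵘ 1ℤ n)) (ℚ.toℚᵘ-fromℚᵘ (ℚᵘ.mkℚᵘ t 0)) ⟨
  ℚ.toℚᵘ (1ℤ / suc n) ℚᵘ.* ℚ.toℚᵘ (t / 1)     ≈⟨ ℚ.toℚᵘ-homo-* (1ℤ / suc n) (t / 1) ⟨
  ℚ.toℚᵘ ((1ℤ / suc n) ℚ.* (t / 1))           ∎)
  where
  open ℚᵘ.≃-Reasoning
  cross : s * + suc (n ℕ.* 1) ≡ 1ℤ * t * 1ℤ
  cross = trans (cong (λ k → s * + suc k) (ℕ.*-identityʳ n))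
    (trans (ℤ.*-comm s (+ suc n)) (trans eq (sym (trans (ℤ.*-identityʳ (1ℤ * t)) (ℤ.*-identityˡ t)))))

theorem3p8 : ∀ (n : ℕ) →
    + smallSchröder 3 (suc n) / 1 ≡
    (1ℤ / suc n) ℚ.*
    ((∑[ i ≤ n ]
    ((- (+ 2)) ^ (n ∸ toℕ i) * + (suc n C toℕ i) *
    (∑[ j ≤ toℕ i ]
    (+ (toℕ i C toℕ j) * + ((2 ℕ.* toℕ i ℕ.+ toℕ j) C n))))) / 1)
theorem3p8 n = divide n (ℤ.*-cancelˡ-≡ (+ 2) (+ suc n * + smallSchröder 3 (suc n)) (sum (summand n)) (begin
  + 2 * (+ suc n * + smallSchröder 3 (suc n))   ≡⟨ swap (+ suc n) (+ smallSchröder 3 (suc n)) ⟩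
  + suc n * (+ 2 * + smallSchröder 3 (suc n))   ≡⟨ smallSchröder-coefficient n ⟩
  (G ^ˢ suc n) n                                ≡⟨ top-power n ⟩
  + 2 * sum (summand n)                         ∎))
  where
  open ≡-Reasoning
  swap : ∀ a b → + 2 * (a * b) ≡ a * (+ 2 * b)
  swap = solve-∀
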